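{- For every integer $n>1$, the graph $H_n$ (defined in the context) is a connected graph all of whose vertices have degree $3$ or $4$, and, writing $s$ for the number of its vertices of degree $3$ and $t$ for the number of its vertices of degree $4$, one has $$\frac{2}{5}\,t+\frac{1}{5}\,s=2n\qquad\text{and}\qquad u(H_n)=2n+2=\frac{2}{5}\,t+\frac{1}{5}\,s+2.$$
   Context: Graphs are finite, undirected, without loops and multiple edges. For a connected graph $G$, $u(G)$ is the maximum, over all spanning trees $F$ of $G$, of the number of leaves (vertices of degree $1$) of $F$. Definition of $H_n$ for $n>1$. For each $i\in\{1,\dots,n\}$ let $D_i$ be the graph on the six vertices $x_i,y_i,z_i,v_i,a_i,b_i$ in which $x_i,y_i,z_i,v_i$ are pairwise adjacent, $a_i$ is adjacent to $x_i$ and $y_i$, $b_i$ is adjacent to $z_i$ and $v_i$, and there are no other edges. The graph $H_n$ is obtained from the disjoint union of $D_1,\dots,D_n$ by adding, for each $i\in\{1,\dots,n\}$, the edge $b_ia_{i+1}$, where the index $n+1$ is understood as $1$. -}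

module Defs where

open import Data.Fin using (Fin; zero; suc; toℕ; _≟_)
open import Data.Fin.Properties using (all?)
open import Data.Integer using (+_)
open import Data.List using (List; []; _∷_; length; filter; allFin; cartesianProduct)
open import Data.List.Membership.Propositional using (_∈_)
open import Data.List.Membership.Propositional.Properties using (∈-allFin; ∈-cartesianProduct⁺)
open import Data.List.Relation.Unary.Unique.Propositional using (Unique)
open import Data.List.Relation.Unary.Unique.Propositional.Properties
  using (allFin⁺; cartesianProduct⁺)
open import Data.Nat as ℕ using (ℕ; suc; _≤_)
open import Data.Nat.DivMod using (_mod_)
open import Data.Product using (_×_; _,_; Σ-syntax; ∃-syntax)
open import Data.Product.Properties using (≡-dec)
open import Data.Rational using (ℚ; _/_)
open import Data.Sum using (_⊎_; inj₁; inj₂; swap)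
open import Function.Definitions using (Injective)
open import Level using (0ℓ)
open import Relation.Binary using (Rel; Decidable; Symmetric; _⇒_)
open import Relation.Binary.Construct.Closure.ReflexiveTransitive using (Star)
open import Relation.Binary.PropositionalEquality using (_≡_; refl; sym)
open import Relation.Nullary using (¬_)
open import Relation.Nullary.Decidable using (¬?; _×-dec_; _⊎-dec_; from-yes)

record FinSet : Set₁ where
  field
    Carrier  : Set
    elements : List Carrier
    unique   : Unique elements
    complete : ∀ p → p ∈ elements

open FinSet using (Carrier; elements)

-- Adjacency is decidable because a finite graph is given by finite data; this
-- also makes degrees computable.
record Graph (V : FinSet) : Set₁ where
  infix 4 _~_ _~?_
  field
    _~_    : Rel (Carrier V) 0ℓ
    _~?_   : Decidable _~_
    ~-sym  : Symmetric _~_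
    ~-irr  : ∀ p → ¬ (p ~ p)

  degree : Carrier V → ℕ
  degree p = length (filter (p ~?_) (elements V))

  numberOfDegree : ℕ → ℕ
  numberOfDegree d = length (filter (λ p → degree p ℕ.≟ d) (elements V))

-- i ↦ i + 1 modulo n.
next : ∀ {n} → Fin n → Fin n
next {suc n} i = suc (toℕ i) mod suc n

module _ {V : FinSet} where

  Connected : Graph V → Set
  Connected G = ∀ p q → Star (Graph._~_ G) p q

  -- A cycle of length k is a cyclic sequence of k ≥ 3 distinct vertices, each
  -- adjacent to the next.
  HasCycle : Graph V → Set
  HasCycle G = ∃[ k ] 3 ≤ k × (Σ[ c ∈ (Fin k → Carrier V) ]
    Injective _≡_ _≡_ c × (∀ i → Graph._~_ G (c i) (c (next i))))

  IsTree : Graph V → Set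
  IsTree G = Connected G × ¬ HasCycle G

  IsSpanningTree : Graph V → Graph V → Set
  IsSpanningTree G F = (Graph._~_ F ⇒ Graph._~_ G) × IsTree F

  leaves : Graph V → ℕ
  leaves F = Graph.numberOfDegree F 1

  -- "u(G) = m": m is attained by a spanning tree of G and bounds them all.
  u[_]≡_ : Graph V → ℕ → Set₁
  u[ G ]≡ m = (Σ[ F ∈ Graph V ] IsSpanningTree G F × leaves F ≡ m)
            × (∀ F → IsSpanningTree G F → leaves F ≤ m)

Label : Set
Label = Fin 6

pattern x = zero
pattern y = suc zero
pattern z = suc (suc zero)
pattern v = suc (suc (suc zero))
pattern a = suc (suc (suc (suc zero)))
pattern b = suc (suc (suc (suc (suc zero))))

Labels : FinSet
Labels = record
  { Carrier = Label ; elements = allFin 6 ; unique = allFin⁺ 6 ; complete = ∈-allFin }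

edgesD : List (Label × Label)
edgesD = (x , y) ∷ (x , z) ∷ (x , v) ∷ (y , z) ∷ (y , v) ∷ (z , v)
       ∷ (a , x) ∷ (a , y) ∷ (b , z) ∷ (b , v) ∷ []

D : Graph Labels
D = record
  { _~_   = _~_
  ; _~?_  = _~?_
  ; ~-sym = swap
  ; ~-irr = from-yes (all? λ p → ¬? (p ~? p))
  }
  where
  open import Data.List.Membership.DecPropositional (≡-dec (_≟_ {6}) (_≟_ {6})) using (_∈?_)

  _~_ : Rel Label 0ℓ
  p ~ q = (p , q) ∈ edgesD ⊎ (q , p) ∈ edgesD

  _~?_ : Decidable _~_
  p ~? q = ((p , q) ∈? edgesD) ⊎-dec ((q , p) ∈? edgesD)

-- The vertex (i , p) is the copy of p in the i-th copy of D; the indices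
-- 1 , … , n are represented by Fin n.
VertexH : ℕ → FinSet
VertexH n = record
  { Carrier  = Fin n × Label
  ; elements = cartesianProduct (allFin n) (allFin 6)
  ; unique   = cartesianProduct⁺ (allFin⁺ n) (allFin⁺ 6)
  ; complete = λ { (i , p) → ∈-cartesianProduct⁺ (∈-allFin i) (∈-allFin p) }
  }

module _ {n : ℕ} where

  SameCopy : Rel (Fin n × Label) 0ℓ
  SameCopy (i , p) (j , q) = i ≡ j × Graph._~_ D p q

  Link : Rel (Fin n × Label) 0ℓ
  Link (i , p) (j , q) = p ≡ b × q ≡ a × j ≡ next i

  AdjH : Rel (Fin n × Label) 0ℓ
  AdjH s t = SameCopy s t ⊎ (Link s t ⊎ Link t s)

  link? : Decidable Link
  link? (i , p) (j , q) = (p ≟ b) ×-dec (q ≟ a) ×-dec (j ≟ next i)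

  adjH? : Decidable AdjH
  adjH? s@(i , p) t@(j , q) =
    ((i ≟ j) ×-dec Graph._~?_ D p q) ⊎-dec (link? s t ⊎-dec link? t s)

  adjH-sym : Symmetric AdjH
  adjH-sym (inj₁ (i≡j , p~q)) = inj₁ (sym i≡j , Graph.~-sym D p~q)
  adjH-sym (inj₂ l)           = inj₂ (swap l)

  adjH-irr : ∀ s → ¬ AdjH s s
  adjH-irr (_ , p) (inj₁ (_ , p~p))                = Graph.~-irr D p p~p
  adjH-irr _       (inj₂ (inj₁ (refl , () , _)))
  adjH-irr _       (inj₂ (inj₂ (refl , () , _)))

H : (n : ℕ) → Graph (VertexH n)
H n = record { _~_ = AdjH ; _~?_ = adjH? ; ~-sym = adjH-sym ; ~-irr = adjH-irr }

fromℕ : ℕ → ℚ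
fromℕ m = + m / 1

{-# OPTIONS --safe #-}
-- Only connectedness of F is needed for the upper bound. Call a cut of the i-th copy of D a set of its vertices that
-- contains a, that no edge of F inside the copy leaves, and that misses b unless F omits the link from b to the next
-- copy. In the order of the copies 1, …, n, a cut splits all vertices into those left of it and those right of it.
-- No edge of F crosses such a splitting except the link that closes the cycle, and there the sides of both ends
-- are forced; since F is connected, any two cuts give the same splitting, so at most one copy has a cut.
-- If x and y are leaves, or if a is a leaf hanging on a link, then a and its neighbours in the copy form a cut;
-- likewise, with complements, for z, v and b. A copy whose links are both present and that has no cut therefore
-- contains at most two leaves. If all links are present, the only copy with a cut has at most four leaves. If a link
-- is missing, then its copy has a cut containing b, so no copy has a cut missing b, and the only further leaves are
-- the ends of the missing link.

module Submission where

open import Defs using (FinSet; Graph; Connected; HasCycle; IsTree; IsSpanningTree; leaves; u[_]≡_;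
  next; Label; D; VertexH; AdjH; H; fromℕ; x; y; z; v; a; b)
open import Data.Bool using (Bool; true; false; not; if_then_else_)
open import Data.Bool.Properties using (not-injective)
open import Data.Fin as Fin using (Fin; zero; suc; toℕ; inject₁) renaming (fromℕ to lastFin)
open import Data.Fin.Properties as Fin
  using (toℕ-injective; toℕ-inject₁; toℕ-fromℕ; toℕ-fromℕ<; toℕ<n; toℕ≤pred[n]; all?; any?)
open import Data.List using (List; []; _∷_; _++_; length; map; filter; allFin; cartesianProduct)
open import Data.List.Extrema.Nat using (argmax; f[xs]≤f[argmax])
open import Data.List.Membership.Propositional using (_∈_)
open import Data.List.Membership.Propositional.Properties
  using (∈-∃++; ∈-++⁺ˡ; ∈-++⁺ʳ; ∈-++⁻; ∈-map⁺; ∈-map⁻; ∈-filter⁺; ∈-filter⁻; ∈-allFin; ∈-cartesianProduct⁻)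
open import Data.List.Properties using (length-++; length-map; length-tabulate; filter-++; filter-≐)
open import Data.List.Relation.Binary.Permutation.Propositional.Properties using (shift; ↭-length)
open import Data.List.Relation.Binary.Subset.Propositional using (_⊆_)
open import Data.List.Relation.Unary.All as All using (All; []; _∷_)
open import Data.List.Relation.Unary.AllPairs using ([]; _∷_)
open import Data.List.Relation.Unary.Any using (here; there)
open import Data.List.Relation.Unary.Unique.Propositional using (Unique)
open import Data.List.Relation.Unary.Unique.Propositional.Properties as Unique using (allFin⁺; cartesianProduct⁺)
open import Data.Integer as ℤ using (+_)
import Data.Integer.Properties as ℤ
open import Data.Maybe using (Maybe; just; nothing)
open import Data.Maybe.Properties as Maybe using (just-injective)
open import Data.Nat as ℕ using (ℕ; zero; suc; _<_; _≤_; z≤n; s≤s; _<?_)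
open import Data.Nat.DivMod using (_%_; n%n≡0; m<n⇒m%n≡m)
open import Data.Nat.Induction using (<-wellFounded)
open import Data.Nat.ListAction using (sum)
open import Data.Nat.Properties as ℕ
  using (≤-refl; ≤-reflexive; ≤-trans; ≤-antisym; ≤⇒≯; ≮⇒≥; <⇒≱; <⇒≢; <-irrefl; m≤n⇒m<n∨m≡n; 1+n≢n; m+1+n≢m;
         suc-injective; +-comm; +-assoc; +-mono-≤; module ≤-Reasoning)
open import Data.Product using (_×_; _,_; proj₁; proj₂)
open import Data.Product.Properties using (≡-dec; ,-injectiveˡ; ,-injectiveʳ)
open import Data.Rational using (_/_; _+_; _*_; toℚᵘ)
import Data.Rational.Properties as ℚ
open import Data.Rational.Unnormalised as ℚᵘ using (mkℚᵘ; *≡*)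
import Data.Rational.Unnormalised.Properties as ℚᵘ
open import Data.Sum using (_⊎_; inj₁; inj₂; [_,_]′; swap)
open import Function using (_∘_; id; case_of_; mk⇔)
open import Level using (0ℓ)
open import Induction.WellFounded using (Acc; acc)
open import Relation.Binary using (DecidableEquality; tri<; tri≈; tri>)
open import Relation.Binary.Construct.Closure.ReflexiveTransitive as Star using (Star; ε; _◅_; _◅◅_)
open import Relation.Binary.PropositionalEquality
open import Relation.Nullary using (¬_; Dec; yes; no; does; contradiction)
open import Relation.Nullary.Decidable
  using (¬?; _×-dec_; _⊎-dec_; _→-dec_; from-yes; from-no; dec-true; dec-false; does-⇔; decidable-stable)
open import Relation.Unary using (Pred; Decidable)

-- Counting: indicators, filtered lists and sums

# : ∀ {ℓ} {P : Set ℓ} → Dec P → ℕ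
# d = if does d then 1 else 0

module _ {A : Set} where

  -- Pigeonhole by induction: once the occurrence of the head is deleted from `ys`, the rest still
  -- contains the tail, which does not repeat the head.
  unique⇒length≤ : {xs ys : List A} → Unique xs → xs ⊆ ys → length xs ≤ length ys
  unique⇒length≤ {[]}     _         _  = z≤n
  unique⇒length≤ {p ∷ xs} (p∉ ∷ xs!) s with ∈-∃++ (s (here refl))
  ... | us , vs , refl =
    ≤-trans (s≤s (unique⇒length≤ xs! rest)) (≤-reflexive (sym (↭-length (shift p us vs))))
    where
    rest : xs ⊆ us ++ vs
    rest q∈ with ∈-++⁻ us (s (there q∈))
    ... | inj₁ q∈us         = ∈-++⁺ˡ q∈us
    ... | inj₂ (here refl)  = contradiction refl (All.lookup p∉ q∈)
    ... | inj₂ (there q∈vs) = ∈-++⁺ʳ us q∈vs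

  unique-equal⇒length≤1 : {xs : List A} → Unique xs → (∀ {p q} → p ∈ xs → q ∈ xs → p ≡ q) → length xs ≤ 1
  unique-equal⇒length≤1 {[]}         _                  _  = z≤n
  unique-equal⇒length≤1 {_ ∷ []}     _                  _  = ≤-refl
  unique-equal⇒length≤1 {_ ∷ _ ∷ _}  ((p≢q ∷ _) ∷ _)    eq = contradiction (eq (here refl) (there (here refl))) p≢q

  length≡1⇒equal : {xs : List A} {p q : A} → length xs ≡ 1 → p ∈ xs → q ∈ xs → p ≡ q
  length≡1⇒equal {_ ∷ []} _ (here refl) (here refl) = refl

  module _ {P : Pred A 0ℓ} (P? : Decidable P) where

    length-filter-# : ∀ xs → length (filter P? xs) ≡ sum (map (λ p → # (P? p)) xs)
    length-filter-# []       = refl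
    length-filter-# (p ∷ xs) with does (P? p)
    ... | true  = cong suc (length-filter-# xs)
    ... | false = length-filter-# xs

    length-filter-map : {B : Set} (f : B → A) (xs : List B) →
      length (filter P? (map f xs)) ≡ length (filter (P? ∘ f) xs)
    length-filter-map f []       = refl
    length-filter-map f (p ∷ xs) with does (P? (f p))
    ... | true  = cong suc (length-filter-map f xs)
    ... | false = length-filter-map f xs

module _ {A B : Set} where

  length-filter-cartesianProduct : {P : Pred (A × B) 0ℓ} (P? : Decidable P) (xs : List A) (ys : List B) →
    length (filter P? (cartesianProduct xs ys)) ≡ sum (map (λ p → length (filter (P? ∘ (p ,_)) ys)) xs)
  length-filter-cartesianProduct P? []       ys = refl
  length-filter-cartesianProduct P? (p ∷ xs) ys = begin
    length (filter P? (map (p ,_) ys ++ cartesianProduct xs ys))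
      ≡⟨ cong length (filter-++ P? (map (p ,_) ys) _) ⟩
    length (filter P? (map (p ,_) ys) ++ filter P? (cartesianProduct xs ys))
      ≡⟨ length-++ (filter P? (map (p ,_) ys)) ⟩
    length (filter P? (map (p ,_) ys)) ℕ.+ length (filter P? (cartesianProduct xs ys))
      ≡⟨ cong₂ ℕ._+_ (length-filter-map P? (p ,_) ys) (length-filter-cartesianProduct P? xs ys) ⟩
    _ ∎
    where open ≡-Reasoning

  length-cartesianProduct : (xs : List A) (ys : List B) →
    length (cartesianProduct xs ys) ≡ length xs ℕ.* length ys
  length-cartesianProduct []       ys = refl
  length-cartesianProduct (p ∷ xs) ys = trans (length-++ (map (p ,_) ys))
    (cong₂ ℕ._+_ (length-map (p ,_) ys) (length-cartesianProduct xs ys))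

sum-const : {A : Set} {f : A → ℕ} {c : ℕ} → (∀ p → f p ≡ c) → ∀ xs → sum (map f xs) ≡ length xs ℕ.* c
sum-const f≡c []       = refl
sum-const f≡c (p ∷ xs) = cong₂ ℕ._+_ (f≡c p) (sum-const f≡c xs)

-- Turns a bound for each copy, with exceptions marked by two predicates, into a bound for the whole
-- graph.
sum-≤-# : {A : Set} {P Q : Pred A 0ℓ} (P? : Decidable P) (Q? : Decidable Q) (f : A → ℕ) {c : ℕ} →
  (∀ p → f p ≤ c ℕ.+ # (P? p) ℕ.+ # (Q? p)) → ∀ xs →
  sum (map f xs) ≤ length xs ℕ.* c ℕ.+ length (filter P? xs) ℕ.+ length (filter Q? xs)
sum-≤-# P? Q? f     f≤ []       = z≤n
sum-≤-# P? Q? f {c} f≤ (p ∷ xs) = ≤-trans (+-mono-≤ (f≤ p) (sum-≤-# P? Q? f f≤ xs)) (≤-reflexive eq)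
  where
  open import Data.Nat.Tactic.RingSolver using (solve-∀)
  lemma : ∀ c d e i j k → c ℕ.+ d ℕ.+ e ℕ.+ (i ℕ.+ j ℕ.+ k) ≡ c ℕ.+ i ℕ.+ (d ℕ.+ j) ℕ.+ (e ℕ.+ k)
  lemma = solve-∀
  length-filter-∷ : {R : Pred _ 0ℓ} (R? : Decidable R) → # (R? p) ℕ.+ length (filter R? xs) ≡ length (filter R? (p ∷ xs))
  length-filter-∷ R? with does (R? p)
  ... | true  = refl
  ... | false = refl
  eq : _
  eq = trans (lemma c (# (P? p)) (# (Q? p)) (length xs ℕ.* c) _ _)
         (cong₂ (λ i j → c ℕ.+ length xs ℕ.* c ℕ.+ i ℕ.+ j) (length-filter-∷ P?) (length-filter-∷ Q?))

length-filter-≤1 : ∀ {n} {P : Pred (Fin n) 0ℓ} (P? : Decidable P) →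
  (∀ {i j} → P i → P j → i ≡ j) → length (filter P? (allFin n)) ≤ 1
length-filter-≤1 {n} P? P! = unique-equal⇒length≤1 (Unique.filter⁺ P? (allFin⁺ n))
  (λ p∈ q∈ → P! (proj₂ (∈-filter⁻ P? {xs = allFin n} p∈)) (proj₂ (∈-filter⁻ P? {xs = allFin n} q∈)))

length-allFin : ∀ n → length (allFin n) ≡ n
length-allFin n = length-tabulate id

-- The cyclic successor

next-cases : ∀ {m} (i : Fin (suc m)) → toℕ (next i) ≡ suc (toℕ i) ⊎ (toℕ i ≡ m × next i ≡ zero)
next-cases {m} i with m≤n⇒m<n∨m≡n (toℕ≤pred[n] i)
... | inj₁ i<m = inj₁ (trans (toℕ-fromℕ< _) (m<n⇒m%n≡m (s≤s i<m)))
... | inj₂ i≡m = inj₂ (i≡m , toℕ-injective (trans (toℕ-fromℕ< _)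
                   (trans (cong (λ k → suc k % suc m) i≡m) (n%n≡0 (suc m)))))

next-inject₁ : ∀ {m} (i : Fin m) → next (inject₁ i) ≡ suc i
next-inject₁ i with next-cases (inject₁ i)
... | inj₁ eq       = toℕ-injective (trans eq (cong suc (toℕ-inject₁ i)))
... | inj₂ (eq , _) = contradiction (trans (sym (toℕ-inject₁ i)) eq) (<⇒≢ (toℕ<n i))

next-last : ∀ m → next (lastFin m) ≡ zero
next-last m with next-cases (lastFin m)
... | inj₁ eq       = contradiction (trans eq (cong suc (toℕ-fromℕ m))) (<⇒≢ (toℕ<n (next (lastFin m))))
... | inj₂ (_ , eq) = eq

prev : ∀ {n} → Fin n → Fin n
prev {suc m} zero    = lastFin m
prev         (suc i) = inject₁ i

next-prev : ∀ {n} (i : Fin n) → next (prev i) ≡ i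
next-prev {suc m} zero    = next-last m
next-prev         (suc i) = next-inject₁ i

next≡⇒prev≡ : ∀ {n} (i j : Fin n) → next i ≡ j → prev j ≡ i
next≡⇒prev≡ {suc m} i j e with next-cases i
next≡⇒prev≡ {suc m} i j       e | inj₂ (eq , eq′) rewrite trans (sym e) eq′ =
  toℕ-injective (trans (toℕ-fromℕ m) (sym eq))
next≡⇒prev≡ {suc m} i zero    e | inj₁ eq = contradiction (trans (sym (cong toℕ e)) eq) λ ()
next≡⇒prev≡ {suc m} i (suc j) e | inj₁ eq =
  toℕ-injective (trans (toℕ-inject₁ j) (suc-injective (trans (sym (cong toℕ e)) eq)))

next≢ : ∀ {n} → 2 ≤ n → (i : Fin n) → next i ≢ i
next≢ {suc _} (s≤s 1≤m) i eq with next-cases i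
... | inj₁ e        = 1+n≢n (trans (sym e) (cong toℕ eq))
... | inj₂ (e , e′) = contradiction (trans (sym (cong toℕ (trans (sym eq) e′))) e) (<⇒≢ 1≤m)

-- On a cycle, whose length is at least 3, this keeps the predecessor and the successor of a
-- position apart.
next-next≢ : ∀ {n} → 3 ≤ n → (i : Fin n) → next (next i) ≢ i
next-next≢ {suc (suc m)} (s≤s (s≤s 1≤m)) i eq with next-cases i | next-cases (next i)
... | inj₁ e       | inj₁ e₁        = m+1+n≢m (toℕ i) {1}
  (trans (+-comm (toℕ i) 2) (trans (cong suc (sym e)) (trans (sym e₁) (cong toℕ eq))))
... | inj₁ e       | inj₂ (e₁ , e₂) = contradiction
  (trans (cong suc (trans (sym (cong toℕ e₂)) (cong toℕ eq))) (trans (sym e) e₁)) (<⇒≢ (s≤s 1≤m))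
... | inj₂ (e , f) | inj₁ e₁        = contradiction
  (trans (cong suc (sym (cong toℕ f))) (trans (sym e₁) (trans (cong toℕ eq) e))) (<⇒≢ (s≤s 1≤m))
... | inj₂ (e , f) | inj₂ (e₁ , _)  = contradiction (trans (sym (cong toℕ f)) e₁) λ ()

-- Degrees and neighbours in an arbitrary graph

module _ {V : FinSet} (G : Graph V) where
  open FinSet V
  open Graph G

  -- Two duplicate-free lists with the same members have equal length, so any such list of the
  -- neighbours gives the degree.
  degree≡length : ∀ {p} {qs : List Carrier} → Unique qs →
    (∀ {q} → p ~ q → q ∈ qs) → (∀ {q} → q ∈ qs → p ~ q) → degree p ≡ length qs
  degree≡length {p} qs! ~⇒∈ ∈⇒~ = ≤-antisym
    (unique⇒length≤ (Unique.filter⁺ (p ~?_) unique) (λ q∈ → ~⇒∈ (proj₂ (∈-filter⁻ (p ~?_) {xs = elements} q∈))))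
    (unique⇒length≤ qs! (λ {q} q∈ → ∈-filter⁺ (p ~?_) (complete q) (∈⇒~ q∈)))

  degree≡1 : ∀ {p q} → p ~ q → (∀ {r} → p ~ r → r ≡ q) → degree p ≡ 1
  degree≡1 p~q q! = degree≡length ([] ∷ []) (λ p~r → here (q! p~r)) λ { (here refl) → p~q }

  leaf-neighbour-unique : ∀ {p q r} → degree p ≡ 1 → p ~ q → p ~ r → q ≡ r
  leaf-neighbour-unique {p} {q} {r} deg p~q p~r =
    length≡1⇒equal deg (∈-filter⁺ (p ~?_) (complete q) p~q) (∈-filter⁺ (p ~?_) (complete r) p~r)

-- Trees given by parent pointers

module ParentTree (V : FinSet) (_≟_ : DecidableEquality (FinSet.Carrier V))
  (parent : FinSet.Carrier V → Maybe (FinSet.Carrier V)) (depth : FinSet.Carrier V → ℕ)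
  (parent-depth : ∀ {p q} → parent p ≡ just q → depth q < depth p)
  (root : FinSet.Carrier V) (parentless⇒root : ∀ {p} → parent p ≡ nothing → p ≡ root) where

  open FinSet V

  tree : Graph V
  tree = record
    { _~_   = λ p q → parent p ≡ just q ⊎ parent q ≡ just p
    ; _~?_  = λ p q → Maybe.≡-dec _≟_ (parent p) (just q) ⊎-dec Maybe.≡-dec _≟_ (parent q) (just p)
    ; ~-sym = swap
    ; ~-irr = λ p → [ <-irrefl refl ∘ parent-depth , <-irrefl refl ∘ parent-depth ]′
    }
  open Graph tree

  -- Recursion on `depth`, which drops at each parent step; the walk ends at a vertex without
  -- parent, hence at the root.
  to-root : ∀ p → Acc _<_ (depth p) → Star _~_ p root
  to-root p (acc rs) with parent p in eq
  ... | nothing rewrite parentless⇒root eq = ε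
  ... | just q  = inj₁ eq ◅ to-root q (rs (parent-depth eq))

  connected : Connected tree
  connected p q = to-root p (<-wellFounded _) ◅◅ Star.reverse ~-sym (to-root q (<-wellFounded _))

  -- Both neighbours of a deepest vertex of a cycle would be its parent.
  acyclic : ¬ HasCycle tree
  acyclic (suc k , 3≤k , c , c-inj , c~) = next-next≢ 3≤k (prev top)
    (trans (cong next (next-prev top)) (c-inj (just-injective (trans (sym parent-next) parent-prev))))
    where
    top : Fin (suc k)
    -- The list contains every position, so the default `zero` does not affect the maximum.
    top = argmax (depth ∘ c) zero (allFin (suc k))

    deepest : ∀ i → depth (c i) ≤ depth (c top)
    deepest i = All.lookup (f[xs]≤f[argmax] {f = depth ∘ c} zero (allFin (suc k))) (∈-allFin i)

    parent-top : ∀ {i} → c top ~ c i → parent (c top) ≡ just (c i)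
    parent-top (inj₁ eq) = eq
    parent-top {i} (inj₂ eq) = contradiction (parent-depth eq) (≤⇒≯ (deepest i))

    parent-next : parent (c top) ≡ just (c (next top))
    parent-next = parent-top (c~ top)

    parent-prev : parent (c top) ≡ just (c (prev top))
    parent-prev = parent-top (~-sym (subst (λ i → c (prev top) ~ c i) (next-prev top) (c~ (prev top))))

  isTree : IsTree tree
  isTree = connected , acyclic

_≟ⱽ_ : ∀ {n} → DecidableEquality (Fin n × Label)
_≟ⱽ_ = ≡-dec Fin._≟_ Fin._≟_

-- The graph H n

module _ where
  open Graph D

  -- Degrees in `H n`, not in `D`: at `a` and `b` the link is counted as well.
  degreeD : Label → ℕ
  degreeD a = 3
  degreeD b = 3
  degreeD _ = 4

  outside : ∀ {n} → Fin n × Label → List (Fin n × Label)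
  outside (i , a) = (prev i , b) ∷ []
  outside (i , b) = (next i , a) ∷ []
  outside _       = []

  nbrsD : Label → List Label
  nbrsD p = filter (p ~?_) (allFin 6)

  neighbours : ∀ {n} → Fin n × Label → List (Fin n × Label)
  neighbours (i , p) = map (i ,_) (nbrsD p) ++ outside (i , p)

  length-neighbours : ∀ {n} (s : Fin n × Label) → length (neighbours s) ≡ degreeD (proj₂ s)
  length-neighbours (i , x) = refl
  length-neighbours (i , y) = refl
  length-neighbours (i , z) = refl
  length-neighbours (i , v) = refl
  length-neighbours (i , a) = refl
  length-neighbours (i , b) = refl

  module _ {n : ℕ} (2≤n : 2 ≤ n) where

    -- Here `n > 1` enters: it makes the two ends of a link lie in different copies.
    outside-copy : ∀ {i : Fin n} {p q} → ¬ ((i , q) ∈ outside (i , p))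
    outside-copy {i} {a} (here eq) = next≢ 2≤n i (trans (cong next (,-injectiveˡ eq)) (next-prev i))
    outside-copy {i} {b} (here eq) = next≢ 2≤n i (sym (,-injectiveˡ eq))

    outside! : ∀ (s : Fin n × Label) → Unique (outside s)
    outside! (i , x) = []
    outside! (i , y) = []
    outside! (i , z) = []
    outside! (i , v) = []
    outside! (i , a) = [] ∷ []
    outside! (i , b) = [] ∷ []

    neighbours! : ∀ (s : Fin n × Label) → Unique (neighbours s)
    neighbours! (i , p) = Unique.++⁺ (Unique.map⁺ ,-injectiveʳ (Unique.filter⁺ (p ~?_) (allFin⁺ 6))) (outside! (i , p))
      λ (q∈ , q∈′) → case ∈-map⁻ (i ,_) q∈ of λ { (q , _ , refl) → outside-copy {p = p} q∈′ }

    ∈outside⇒AdjH : ∀ {s t : Fin n × Label} → t ∈ outside s → AdjH s t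
    ∈outside⇒AdjH {i , a} (here refl) = inj₂ (inj₂ (refl , refl , sym (next-prev i)))
    ∈outside⇒AdjH {i , b} (here refl) = inj₂ (inj₁ (refl , refl , refl))

    AdjH⇒∈neighbours : ∀ {s t : Fin n × Label} → AdjH s t → t ∈ neighbours s
    AdjH⇒∈neighbours {i , p} {_ , q} (inj₁ (refl , p~q)) =
      ∈-++⁺ˡ (∈-map⁺ (i ,_) (∈-filter⁺ (p ~?_) (∈-allFin q) p~q))
    AdjH⇒∈neighbours {i , p} (inj₂ (inj₁ (refl , refl , refl))) = ∈-++⁺ʳ (map (i ,_) (nbrsD p)) (here refl)
    AdjH⇒∈neighbours {i , p} {j , _} (inj₂ (inj₂ (refl , refl , eq))) =
      ∈-++⁺ʳ (map (i ,_) (nbrsD p)) (here (cong (_, b) (sym (next≡⇒prev≡ j i (sym eq)))))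

    ∈neighbours⇒AdjH : ∀ {s t : Fin n × Label} → t ∈ neighbours s → AdjH s t
    ∈neighbours⇒AdjH {i , p} t∈ with ∈-++⁻ (map (i ,_) (nbrsD p)) t∈
    ... | inj₂ t∈out = ∈outside⇒AdjH t∈out
    ... | inj₁ t∈in with ∈-map⁻ (i ,_) t∈in
    ...   | q , q∈ , refl = inj₁ (refl , proj₂ (∈-filter⁻ (p ~?_) {xs = allFin 6} q∈))

    degreeH : ∀ (s : Fin n × Label) → Graph.degree (H n) s ≡ degreeD (proj₂ s)
    degreeH s = trans (degree≡length (H n) (neighbours! s) AdjH⇒∈neighbours ∈neighbours⇒AdjH) (length-neighbours s)

    -- The degree depends on the label alone, so all copies contribute the same number, which
    -- evaluates for a concrete `d`.
    numberOfDegreeH : ∀ d → Graph.numberOfDegree (H n) d ≡ n ℕ.* length (filter (λ p → degreeD p ℕ.≟ d) (allFin 6))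
    numberOfDegreeH d = begin
      length (filter (λ s → Graph.degree (H n) s ℕ.≟ d) vertices)
        ≡⟨ cong length (filter-≐ _ (λ s → degreeD (proj₂ s) ℕ.≟ d)
             ((λ {s} → trans (sym (degreeH s))) , λ {s} → trans (degreeH s)) vertices) ⟩
      length (filter (λ s → degreeD (proj₂ s) ℕ.≟ d) vertices)
        ≡⟨ length-filter-cartesianProduct (λ s → degreeD (proj₂ s) ℕ.≟ d) (allFin n) (allFin 6) ⟩
      sum (map (λ _ → length (filter (λ p → degreeD p ℕ.≟ d) (allFin 6))) (allFin n))
        ≡⟨ sum-const (λ _ → refl) (allFin n) ⟩
      length (allFin n) ℕ.* length (filter (λ p → degreeD p ℕ.≟ d) (allFin 6))
        ≡⟨ cong (ℕ._* _) (length-allFin n) ⟩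
      _ ∎
      where
      open ≡-Reasoning
      vertices = cartesianProduct (allFin n) (allFin 6)

degreeD-3-or-4 : ∀ p → degreeD p ≡ 3 ⊎ degreeD p ≡ 4
degreeD-3-or-4 = from-yes (all? λ p → (degreeD p ℕ.≟ 3) ⊎-dec (degreeD p ℕ.≟ 4))

-- The caterpillar attaining the bound

module Caterpillar (m : ℕ) where

  Vertex : Set
  Vertex = Fin (suc m) × Label

  -- The spine runs through `a`, `x`, `z`, `b` in each copy and along all links but the one closing
  -- the cycle; `y` and `v` hang on it. Its two ends are leaves as well.
  parent : Vertex → Maybe Vertex
  parent (i     , x) = just (i , a)
  parent (i     , y) = just (i , x)
  parent (i     , z) = just (i , x)
  parent (i     , v) = just (i , z)
  parent (i     , b) = just (i , z)
  parent (zero  , a) = nothing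
  parent (suc i , a) = just (inject₁ i , b)

  depthD : Label → ℕ
  depthD a = 0
  depthD x = 1
  depthD y = 2
  depthD z = 2
  depthD v = 3
  depthD b = 3

  -- The spine has four vertices in each copy, hence the factor 4.
  depth : Vertex → ℕ
  depth (i , p) = depthD p ℕ.+ toℕ i ℕ.* 4

  parent-depth : ∀ {s t} → parent s ≡ just t → depth t < depth s
  parent-depth {i     , x} refl = ≤-refl
  parent-depth {i     , y} refl = ≤-refl
  parent-depth {i     , z} refl = ≤-refl
  parent-depth {i     , v} refl = ≤-refl
  parent-depth {i     , b} refl = ≤-refl
  parent-depth {suc i , a} refl rewrite toℕ-inject₁ i = ≤-refl

  parentless⇒root : ∀ {s} → parent s ≡ nothing → s ≡ (zero , a)
  parentless⇒root {_    , b} ()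
  parentless⇒root {zero , a} _ = refl

  open ParentTree (VertexH (suc m)) _≟ⱽ_ parent depth parent-depth (zero , a) parentless⇒root public

  open Graph D using (_~_; _~?_)

  parent⇒AdjH : ∀ {s t} → parent s ≡ just t → AdjH s t
  parent⇒AdjH {i     , x} refl = inj₁ (refl , from-yes (_~?_ x a))
  parent⇒AdjH {i     , y} refl = inj₁ (refl , from-yes (_~?_ y x))
  parent⇒AdjH {i     , z} refl = inj₁ (refl , from-yes (_~?_ z x))
  parent⇒AdjH {i     , v} refl = inj₁ (refl , from-yes (_~?_ v z))
  parent⇒AdjH {i     , b} refl = inj₁ (refl , from-yes (_~?_ b z))
  parent⇒AdjH {suc i , a} refl = inj₂ (inj₂ (refl , refl , sym (next-inject₁ i)))

  isSpanningTree : IsSpanningTree (H (suc m)) tree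
  isSpanningTree = [ parent⇒AdjH , Graph.~-sym (H (suc m)) ∘ parent⇒AdjH ]′ , isTree

  leafList : List Vertex
  leafList = cartesianProduct (allFin (suc m)) (y ∷ v ∷ []) ++ (zero , a) ∷ (lastFin m , b) ∷ []

  length-leafList : length leafList ≡ suc m ℕ.* 2 ℕ.+ 2
  length-leafList = trans (length-++ (cartesianProduct (allFin (suc m)) (y ∷ v ∷ [])))
    (cong (ℕ._+ 2) (trans (length-cartesianProduct (allFin (suc m)) (y ∷ v ∷ [])) (cong (ℕ._* 2) (length-allFin (suc m)))))

  leafList! : Unique leafList
  leafList! = Unique.++⁺ (cartesianProduct⁺ (allFin⁺ (suc m)) (((λ ()) ∷ []) ∷ [] ∷ []))
    (((λ ()) ∷ []) ∷ [] ∷ []) (λ (s∈ , s∈′) → disjoint (proj₂ (∈-cartesianProduct⁻ (allFin (suc m)) _ s∈)) s∈′)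
    where
    disjoint : ∀ {s} → proj₂ s ∈ y ∷ v ∷ [] → ¬ (s ∈ (zero , a) ∷ (lastFin m , b) ∷ [])
    disjoint (here ())         (here refl)
    disjoint (there (here ())) (here refl)
    disjoint (here ())         (there (here refl))
    disjoint (there (here ())) (there (here refl))

  -- An indexed family, so that absurd patterns exclude `y` and `v`; `inject₁` leaves out `b` of the
  -- last copy.
  data HasChild : Vertex → Set where
    at-a : ∀ {i} → HasChild (i , a)
    at-x : ∀ {i} → HasChild (i , x)
    at-z : ∀ {i} → HasChild (i , z)
    at-b : ∀ (i : Fin m) → HasChild (inject₁ i , b)

  parent⇒hasChild : ∀ r {s} → parent r ≡ just s → HasChild s
  parent⇒hasChild (_     , x) refl = at-a
  parent⇒hasChild (_     , y) refl = at-x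
  parent⇒hasChild (_     , z) refl = at-x
  parent⇒hasChild (_     , v) refl = at-z
  parent⇒hasChild (_     , b) refl = at-z
  parent⇒hasChild (suc i , a) refl = at-b i

  childless⇒leaf : ∀ {s t} → parent s ≡ just t → ¬ HasChild s → Graph.degree tree s ≡ 1
  childless⇒leaf eq childless = degree≡1 tree (inj₁ eq) λ
    { (inj₁ eq′) → just-injective (trans (sym eq′) eq)
    ; {r} (inj₂ eq′) → contradiction (parent⇒hasChild r eq′) childless }

  -- The equation makes the match on `at-b` possible, since `inject₁ i` and `lastFin m` do not
  -- unify; their values differ.
  last-childless : ∀ {s} → s ≡ (lastFin m , b) → ¬ HasChild s
  last-childless eq (at-b i) = contradiction
    (trans (sym (toℕ-inject₁ i)) (trans (cong toℕ (,-injectiveˡ eq)) (toℕ-fromℕ m))) (<⇒≢ (toℕ<n i))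

  leaf : ∀ {s} → s ∈ leafList → Graph.degree tree s ≡ 1
  leaf {s} s∈ with ∈-++⁻ (cartesianProduct (allFin (suc m)) (y ∷ v ∷ [])) s∈
  ... | inj₁ s∈yv with s | proj₂ (∈-cartesianProduct⁻ (allFin (suc m)) (y ∷ v ∷ []) s∈yv)
  ...   | i , _ | here refl         = childless⇒leaf {i , y} refl λ ()
  ...   | i , _ | there (here refl) = childless⇒leaf {i , v} refl λ ()
  -- The root is a leaf for another reason: it has no parent, and `x` is its only child.
  leaf s∈ | inj₂ (here refl) = degree≡1 tree {q = zero , x} (inj₂ refl)
    λ { {_ , x} (inj₂ refl) → refl ; {suc _ , a} (inj₂ ()) ; {_ , b} (inj₂ ()) }
  leaf s∈ | inj₂ (there (here refl)) = childless⇒leaf {lastFin m , b} refl (last-childless refl)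

  -- A lower bound suffices, since the upper bound for all spanning trees applies to this one too.
  leaves≥ : suc m ℕ.* 2 ℕ.+ 2 ≤ leaves tree
  leaves≥ = ≤-trans (≤-reflexive (sym length-leafList)) (unique⇒length≤ leafList!
    λ {s} s∈ → ∈-filter⁺ (λ t → Graph.degree tree t ℕ.≟ 1) (FinSet.complete (VertexH (suc m)) s) (leaf s∈))

-- Indicators of decidable propositions

#≤1 : {P : Set} (P? : Dec P) → # P? ≤ 1
#≤1 P? with does P?
... | true  = ≤-refl
... | false = z≤n

#≡0 : {P : Set} (P? : Dec P) → ¬ P → # P? ≡ 0
#≡0 P? ¬p = cong (if_then 1 else 0) (dec-false P? ¬p)

#≡1 : {P : Set} (P? : Dec P) → P → # P? ≡ 1
#≡1 P? p = cong (if_then 1 else 0) (dec-true P? p)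

#-mono : {P Q : Set} (P? : Dec P) (Q? : Dec Q) → (P → Q) → # P? ≤ # Q?
#-mono (yes p) Q? p⇒q = ≤-reflexive (sym (#≡1 Q? (p⇒q p)))
#-mono (no _)  Q? p⇒q = z≤n

#+#≤1 : {P Q : Set} (P? : Dec P) (Q? : Dec Q) → ¬ (P × Q) → # P? ℕ.+ # Q? ≤ 1
#+#≤1 (yes p) Q? ¬pq = ≤-reflexive (cong suc (#≡0 Q? λ q → ¬pq (p , q)))
#+#≤1 (no _)  Q? ¬pq = #≤1 Q?

-- Upper bound

module UpperBound (m : ℕ) (F : Graph (VertexH (suc (suc m))))
  (F⊆H : ∀ {s t} → Graph._~_ F s t → AdjH s t) (F-connected : Connected F) where

  open Graph F

  n : ℕ
  n = suc (suc m)

  Vertex : Set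
  Vertex = Fin n × Label

  Leaf : Vertex → Set
  Leaf s = degree s ≡ 1

  leaf? : Decidable Leaf
  leaf? s = degree s ℕ.≟ 1

  Linked : Fin n → Set
  Linked i = (i , b) ~ (next i , a)

  linked? : Decidable Linked
  linked? i = (i , b) ~? (next i , a)

  next≢i : (i : Fin n) → next i ≢ i
  next≢i = next≢ (s≤s (s≤s z≤n))

  prev≢i : (i : Fin n) → prev i ≢ i
  prev≢i i eq = next≢i i (trans (cong next (sym eq)) (next-prev i))

  -- A link within one copy would need `next i ≡ i`, which fails for `n > 1`.
  inside : ∀ {i p q} → (i , p) ~ (i , q) → Graph._~_ D p q
  inside {i} e with F⊆H e
  ... | inj₁ (_ , p~q)               = p~q
  ... | inj₂ (inj₁ (_ , _ , i≡next)) = contradiction (sym i≡next) (next≢i i)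
  ... | inj₂ (inj₂ (_ , _ , i≡next)) = contradiction (sym i≡next) (next≢i i)

  -- Cuts and the splittings they induce

  record Cut (i : Fin n) : Set where
    field
      side   : Label → Bool
      a-side : side a ≡ true
      closed : ∀ {p q} → (i , p) ~ (i , q) → side p ≡ side q
      b-side : Linked i → side b ≡ false

  open Cut

  left : ∀ {i} → Cut i → Vertex → Bool
  left {i} C (k , p) with Fin.<-cmp k i
  ... | tri< _ _ _ = true
  ... | tri≈ _ _ _ = side C p
  ... | tri> _ _ _ = false

  module _ {i : Fin n} (C : Cut i) where

    left-before : ∀ {k p} → k Fin.< i → left C (k , p) ≡ true
    left-before {k} k<i with Fin.<-cmp k i
    ... | tri< _ _ _   = refl
    ... | tri≈ k≮i _ _ = contradiction k<i k≮i
    ... | tri> k≮i _ _ = contradiction k<i k≮i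

    left-at : ∀ {p} → left C (i , p) ≡ side C p
    left-at with Fin.<-cmp i i
    ... | tri< _ i≢i _ = contradiction refl i≢i
    ... | tri≈ _ _ _   = refl
    ... | tri> _ i≢i _ = contradiction refl i≢i

    left-after : ∀ {k p} → i Fin.< k → left C (k , p) ≡ false
    left-after {k} i<k with Fin.<-cmp k i
    ... | tri< _ _ i≮k = contradiction i<k i≮k
    ... | tri≈ _ _ i≮k = contradiction i<k i≮k
    ... | tri> _ _ _   = refl

    left-a : ∀ {k} → k Fin.≤ i → left C (k , a) ≡ true
    left-a {k} k≤i with m≤n⇒m<n∨m≡n k≤i
    ... | inj₁ k<i = left-before k<i
    ... | inj₂ k≡i with refl ← toℕ-injective k≡i = trans left-at (a-side C)

    -- With `left-a`, this reads the index of a cut off its splitting: it is the last copy whose `a`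
    -- lies on the left.
    left-a⁻¹ : ∀ {k} → left C (k , a) ≡ true → k Fin.≤ i
    left-a⁻¹ eq = ≮⇒≥ λ i<k → contradiction (trans (sym eq) (left-after i<k)) λ ()

    left-b : ∀ {k} → Linked k → i Fin.≤ k → left C (k , b) ≡ false
    left-b {k} l i≤k with m≤n⇒m<n∨m≡n i≤k
    ... | inj₁ i<k = left-after i<k
    ... | inj₂ i≡k with refl ← toℕ-injective i≡k = trans left-at (b-side C l)

    left-inside : ∀ {k p q} → (k , p) ~ (k , q) → left C (k , p) ≡ left C (k , q)
    left-inside {k} e with Fin.<-cmp k i
    ... | tri< _ _ _    = refl
    ... | tri≈ _ refl _ = closed C e
    ... | tri> _ _ _    = refl

    -- Before copy `i` both ends are on the left, by `a-side` if the link enters copy `i`; from copy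
    -- `i` on both are on the right, by `b-side` if `k ≡ i`.
    left-link : ∀ {k} → Linked k → toℕ (next k) ≡ suc (toℕ k) → left C (k , b) ≡ left C (next k , a)
    left-link {k} l eq with toℕ k <? toℕ i
    ... | yes k<i = trans (left-before k<i) (sym (left-a (≤-trans (≤-reflexive eq) k<i)))
    ... | no k≮i  = trans (left-b l (≮⇒≥ k≮i)) (sym (left-after (≤-trans (s≤s (≮⇒≥ k≮i)) (≤-reflexive (sym eq)))))

    -- With `left-zero`: the closing link, if present, crosses every splitting from right to left,
    -- so its ends have the same sides for all cuts.
    left-link-last : ∀ {k} → Linked k → toℕ k ≡ suc m → left C (k , b) ≡ false
    left-link-last l eq = left-b l (≤-trans (toℕ≤pred[n] i) (≤-reflexive (sym eq)))

    left-zero : ∀ {k} → k ≡ zero → left C (k , a) ≡ true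
    left-zero refl = left-a z≤n

  -- Both splittings are constant along any edge but the closing link, and at the ends of that link
  -- they agree anyway.
  left-step : ∀ {i j} (C : Cut i) (C′ : Cut j) {s t} → s ~ t → left C s ≡ left C′ s → left C t ≡ left C′ t
  left-step C C′ {k , _} e eq with F⊆H e
  ... | inj₁ (refl , _) = trans (sym (left-inside C e)) (trans eq (left-inside C′ e))
  ... | inj₂ (inj₁ (refl , refl , refl)) with next-cases k
  ...   | inj₁ suc-k      = trans (sym (left-link C e suc-k)) (trans eq (left-link C′ e suc-k))
  ...   | inj₂ (_ , eq₀) = trans (left-zero C eq₀) (sym (left-zero C′ eq₀))
  left-step C C′ {_} {k , _} e eq | inj₂ (inj₂ (refl , refl , refl)) with next-cases k
  ...   | inj₁ suc-k      = trans (left-link C (~-sym e) suc-k) (trans eq (sym (left-link C′ (~-sym e) suc-k)))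
  ...   | inj₂ (last , _) = trans (left-link-last C (~-sym e) last) (sym (left-link-last C′ (~-sym e) last))

  -- Every splitting has `(zero , a)` on the left; agreement spreads from there along walks in `F`.
  left-unique : ∀ {i j} (C : Cut i) (C′ : Cut j) → ∀ s → left C s ≡ left C′ s
  left-unique C C′ s = walk (F-connected (zero , a) s) (trans (left-a C z≤n) (sym (left-a C′ z≤n)))
    where
    walk : ∀ {s t} → Star _~_ s t → left C s ≡ left C′ s → left C t ≡ left C′ t
    walk ε        eq = eq
    walk (e ◅ es) eq = walk es (left-step C C′ e eq)

  -- The vertex `a` of copy `i` is left of `C`, hence left of `C′`, which gives `i ≤ j`; the
  -- converse is symmetric.
  cut-index-unique : ∀ {i j} → Cut i → Cut j → i ≡ j
  cut-index-unique {i} {j} C C′ = toℕ-injective (≤-antisym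
    (left-a⁻¹ C′ (trans (sym (left-unique C C′ (i , a))) (left-a C ≤-refl)))
    (left-a⁻¹ C (trans (left-unique C C′ (j , a)) (left-a C′ ≤-refl))))

  side-unique : ∀ {i} (C C′ : Cut i) p → side C p ≡ side C′ p
  side-unique {i} C C′ p = trans (sym (left-at C)) (trans (left-unique C C′ (i , p)) (left-at C′))

  -- The whole copy serves as the cut: `b-side` is vacuous when the link is missing.
  linkCut : ∀ {i} → ¬ Linked i → Cut i
  linkCut ¬l = record { side = λ _ → true ; a-side = refl ; closed = λ _ → refl ; b-side = λ l → contradiction l ¬l }

  -- Cuts from balls around `a` and `b`

  module _ (i : Fin n) where

    -- The closed neighbourhood of `c` in `F`, restricted to the copy.
    Ball : Label → Label → Set
    Ball c p = p ≡ c ⊎ (i , c) ~ (i , p)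

    ball? : ∀ c → Decidable (Ball c)
    ball? c p = (p Fin.≟ c) ⊎-dec ((i , c) ~? (i , p))

    LeafyAt : Label → Set
    LeafyAt c = ∀ p → (i , c) ~ (i , p) → Leaf (i , p)

    -- A neighbour of `c` in the copy is a leaf, so an edge from it can only lead back to `c`.
    ball-step : ∀ {c p q} → LeafyAt c → (i , p) ~ (i , q) → Ball c p → Ball c q
    ball-step leafy p~q (inj₁ refl) = inj₂ p~q
    ball-step leafy p~q (inj₂ c~p)  = inj₁ (,-injectiveʳ (leaf-neighbour-unique F (leafy _ c~p) p~q (~-sym c~p)))

    ball-closed : ∀ {c p q} → LeafyAt c → (i , p) ~ (i , q) → does (ball? c p) ≡ does (ball? c q)
    ball-closed {c} {p} {q} leafy p~q =
      does-⇔ (mk⇔ (ball-step leafy p~q) (ball-step leafy (~-sym p~q))) (ball? c p) (ball? c q)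

    ¬ball : ∀ {c p} → p ≢ c → ¬ Graph._~_ D c p → does (ball? c p) ≡ false
    ¬ball {c} {p} p≢c ¬c~p = dec-false (ball? c p) [ p≢c , ¬c~p ∘ inside ]′

    aCut : LeafyAt a → Cut i
    aCut leafy = record
      { side   = λ p → does (ball? a p)
      ; a-side = refl
      ; closed = ball-closed leafy
      ; b-side = λ _ → ¬ball (λ ()) (from-no (Graph._~?_ D a b))
      }

    -- The complement of the ball is taken because a cut contains `a`.
    bCut : LeafyAt b → Cut i
    bCut leafy = record
      { side   = λ p → not (does (ball? b p))
      ; a-side = cong not (¬ball (λ ()) (from-no (Graph._~?_ D b a)))
      ; closed = λ p~q → cong not (ball-closed leafy p~q)
      ; b-side = λ _ → refl
      }

    -- The only edge at the leaf goes to another copy, so the condition on neighbours in its own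
    -- copy is vacuous.
    leaf⇒leafy : ∀ {c j q} → Leaf (i , c) → (i , c) ~ (j , q) → j ≢ i → LeafyAt c
    leaf⇒leafy leaf e j≢i _ e′ = contradiction (,-injectiveˡ (leaf-neighbour-unique F leaf e e′)) j≢i

    xy⇒leafy : Leaf (i , x) × Leaf (i , y) → LeafyAt a
    xy⇒leafy (leaf-x , leaf-y) p e = [ (λ { refl → leaf-x }) , (λ { refl → leaf-y }) ]′
      (from-yes (all? λ p → Graph._~?_ D a p →-dec ((p Fin.≟ x) ⊎-dec (p Fin.≟ y))) p (inside e))

    zv⇒leafy : Leaf (i , z) × Leaf (i , v) → LeafyAt b
    zv⇒leafy (leaf-z , leaf-v) p e = [ (λ { refl → leaf-z }) , (λ { refl → leaf-v }) ]′
      (from-yes (all? λ p → Graph._~?_ D b p →-dec ((p Fin.≟ z) ⊎-dec (p Fin.≟ v))) p (inside e))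

    -- The ball around a and the complement of the ball around b are the same cut.
    leafy-leafy : LeafyAt a → LeafyAt b → (i , a) ~ (i , x) × (i , b) ~ (i , z)
    leafy-leafy leafy-a leafy-b = a~x , b~z
      where
      same-side : ∀ p → does (ball? a p) ≡ not (does (ball? b p))
      same-side = side-unique (aCut leafy-a) (bCut leafy-b)

      in-ball : ∀ {c p} → does (ball? c p) ≡ true → p ≢ c → (i , c) ~ (i , p)
      in-ball {c} {p} eq p≢c with ball? c p
      ... | yes (inj₁ p≡c) = contradiction p≡c p≢c
      ... | yes (inj₂ c~p) = c~p
      ... | no ¬ball       = contradiction (trans (sym eq) (dec-false (ball? c p) ¬ball)) λ ()

      -- As `x` is outside the ball around `b`, it is inside the ball around `a`; likewise for `z`
      -- with the balls exchanged.
      a~x = in-ball (trans (same-side x) (cong not (¬ball (λ ()) (from-no (Graph._~?_ D b x))))) λ ()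
      b~z = in-ball (not-injective (trans (sym (same-side z)) (¬ball (λ ()) (from-no (Graph._~?_ D a z))))) λ ()

    -- Leaves in a single copy

    leafCount : ℕ
    leafCount = length (filter (λ p → leaf? (i , p)) (allFin 6))

    #leaf : Label → ℕ
    #leaf p = # (leaf? (i , p))

    leafCount-# : leafCount ≡ (#leaf a ℕ.+ (#leaf x ℕ.+ #leaf y)) ℕ.+ (#leaf b ℕ.+ (#leaf z ℕ.+ #leaf v))
    leafCount-# = trans (length-filter-# (λ p → leaf? (i , p)) (allFin 6))
      (rearrange (#leaf a) (#leaf b) (#leaf x) (#leaf y) (#leaf z) (#leaf v))
      where
      open import Data.Nat.Tactic.RingSolver using (solve-∀)
      rearrange : ∀ i j k l r s → k ℕ.+ (l ℕ.+ (r ℕ.+ (s ℕ.+ (i ℕ.+ (j ℕ.+ 0))))) ≡ (i ℕ.+ (k ℕ.+ l)) ℕ.+ (j ℕ.+ (r ℕ.+ s))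
      rearrange = solve-∀

    -- If a half has more than one leaf, then `c` is a leaf or both `p` and `q` are, and either
    -- makes `c` leafy.
    half : ∀ {c p q} → (Leaf (i , c) → LeafyAt c) → (Leaf (i , p) × Leaf (i , q) → LeafyAt c) →
      LeafyAt c ⊎ (#leaf c ℕ.+ (#leaf p ℕ.+ #leaf q) ≤ 1)
    half {c} {p} {q} c⇒leafy pq⇒leafy with leaf? (i , c) | leaf? (i , p) ×-dec leaf? (i , q)
    ... | yes leaf | _       = inj₁ (c⇒leafy leaf)
    ... | no _     | yes pq  = inj₁ (pq⇒leafy pq)
    ... | no ¬leaf | no ¬pq  =
      inj₂ (+-mono-≤ (≤-reflexive (#≡0 (leaf? (i , c)) ¬leaf)) (#+#≤1 (leaf? (i , p)) (leaf? (i , q)) ¬pq))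

    half≤3 : ∀ c p q → #leaf c ℕ.+ (#leaf p ℕ.+ #leaf q) ≤ 3
    half≤3 c p q = +-mono-≤ (#≤1 (leaf? (i , c))) (+-mono-≤ (#≤1 (leaf? (i , p))) (#≤1 (leaf? (i , q))))

    half≤2 : ∀ c p q → ¬ Leaf (i , c) → #leaf c ℕ.+ (#leaf p ℕ.+ #leaf q) ≤ 2
    half≤2 c p q ¬leaf = +-mono-≤ (≤-reflexive (#≡0 (leaf? (i , c)) ¬leaf)) (+-mono-≤ (#≤1 (leaf? (i , p))) (#≤1 (leaf? (i , q))))

    -- A single leafy half has at most three leaves and the other half at most one. If both are
    -- leafy, `a` and `b` each have an edge in the copy besides the link, so neither is a leaf.
    linked⇒leafCount≤ : (i , a) ~ (prev i , b) → Linked i → leafCount ≤ 2 ⊎ (Cut i × leafCount ≤ 4)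
    linked⇒leafCount≤ a~ b~ with half {a} {x} {y} (λ leaf → leaf⇒leafy leaf a~ (prev≢i i)) xy⇒leafy
                               | half {b} {z} {v} (λ leaf → leaf⇒leafy leaf b~ (next≢i i)) zv⇒leafy
    ... | inj₂ a≤1     | inj₂ b≤1     = inj₁ (≤-trans (≤-reflexive leafCount-#) (+-mono-≤ a≤1 b≤1))
    ... | inj₁ leafy-a | inj₂ b≤1     = inj₂ (aCut leafy-a , ≤-trans (≤-reflexive leafCount-#) (+-mono-≤ (half≤3 a x y) b≤1))
    ... | inj₂ a≤1     | inj₁ leafy-b = inj₂ (bCut leafy-b , ≤-trans (≤-reflexive leafCount-#) (+-mono-≤ a≤1 (half≤3 b z v)))
    ... | inj₁ leafy-a | inj₁ leafy-b with leafy-leafy leafy-a leafy-b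
    ...   | a~x , b~z = inj₂ (aCut leafy-a , ≤-trans (≤-reflexive leafCount-#)
      (+-mono-≤ (half≤2 a x y λ leaf → case leaf-neighbour-unique F leaf a~ a~x of λ ())
                (half≤2 b z v λ leaf → case leaf-neighbour-unique F leaf b~ b~z of λ ())))

  -- Summation over all copies

  leaves≡ : leaves F ≡ sum (map leafCount (allFin n))
  leaves≡ = length-filter-cartesianProduct leaf? (allFin n) (allFin 6)

  -- Each predicate marks at most one copy, so the surplus over two leaves per copy is at most 2 in
  -- all.
  leaves≤-by : {P Q : Pred (Fin n) 0ℓ} (P? : Decidable P) (Q? : Decidable Q) →
    (∀ {i j} → P i → P j → i ≡ j) → (∀ {i j} → Q i → Q j → i ≡ j) →
    (∀ i → leafCount i ≤ 2 ℕ.+ # (P? i) ℕ.+ # (Q? i)) → leaves F ≤ n ℕ.* 2 ℕ.+ 2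
  leaves≤-by P? Q? P! Q! bound = begin
    leaves F                      ≡⟨ leaves≡ ⟩
    sum (map leafCount (allFin n)) ≤⟨ sum-≤-# P? Q? leafCount bound (allFin n) ⟩
    length (allFin n) ℕ.* 2 ℕ.+ length (filter P? (allFin n)) ℕ.+ length (filter Q? (allFin n))
      ≤⟨ +-mono-≤ (+-mono-≤ (≤-reflexive (cong (ℕ._* 2) (length-allFin n))) (length-filter-≤1 P? P!)) (length-filter-≤1 Q? Q!) ⟩
    n ℕ.* 2 ℕ.+ 1 ℕ.+ 1           ≡⟨ +-assoc (n ℕ.* 2) 1 1 ⟩
    n ℕ.* 2 ℕ.+ 2                 ∎
    where open ≤-Reasoning

  ¬linked⇒leaves≤ : ∀ {k} → ¬ Linked k → leaves F ≤ n ℕ.* 2 ℕ.+ 2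
  ¬linked⇒leaves≤ {k} ¬linked = leaves≤-by (Fin._≟ next k) (Fin._≟ k)
    (λ p q → trans p (sym q)) (λ p q → trans p (sym q)) bound
    where
    -- Every cut agrees with the one from the missing link, and that one contains `b`.
    no-proper-cut : ∀ {i} (C : Cut i) → side C b ≢ false
    no-proper-cut C eq with refl ← cut-index-unique C (linkCut ¬linked) =
      contradiction (trans (sym eq) (side-unique C (linkCut ¬linked) b)) λ ()

    module _ (i : Fin n) where
      ¬leafy-a : ¬ LeafyAt i a
      ¬leafy-a leafy = no-proper-cut (aCut i leafy) (¬ball i (λ ()) (from-no (Graph._~?_ D a b)))

      ¬leafy-b : ¬ LeafyAt i b
      ¬leafy-b leafy = no-proper-cut (bCut i leafy) refl

      -- On a present link a leaf `a` would be leafy, so the link from `prev i` is missing; a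
      -- missing link gives a cut, hence starts in copy `k`.
      leaf-a : Leaf (i , a) → i ≡ next k
      leaf-a leaf with linked? (prev i)
      ... | no ¬l = trans (sym (next-prev i)) (cong next (cut-index-unique (linkCut ¬l) (linkCut ¬linked)))
      ... | yes l = contradiction
        (leaf⇒leafy i leaf (subst (λ j → (j , a) ~ (prev i , b)) (next-prev i) (~-sym l)) (prev≢i i))
        ¬leafy-a

      leaf-b : Leaf (i , b) → i ≡ k
      leaf-b leaf with linked? i
      ... | no ¬l = cut-index-unique (linkCut ¬l) (linkCut ¬linked)
      ... | yes l = contradiction (leaf⇒leafy i leaf l (next≢i i)) ¬leafy-b

      bound : leafCount i ≤ 2 ℕ.+ # (i Fin.≟ next k) ℕ.+ # (i Fin.≟ k)
      bound = begin
        leafCount i ≡⟨ leafCount-# i ⟩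
        (# (leaf? (i , a)) ℕ.+ (# (leaf? (i , x)) ℕ.+ # (leaf? (i , y)))) ℕ.+
        (# (leaf? (i , b)) ℕ.+ (# (leaf? (i , z)) ℕ.+ # (leaf? (i , v))))
          ≤⟨ +-mono-≤
               (+-mono-≤ (#-mono (leaf? (i , a)) (i Fin.≟ next k) leaf-a) (#+#≤1 (leaf? (i , x)) (leaf? (i , y)) λ xy → ¬leafy-a (xy⇒leafy i xy)))
               (+-mono-≤ (#-mono (leaf? (i , b)) (i Fin.≟ k) leaf-b) (#+#≤1 (leaf? (i , z)) (leaf? (i , v)) λ zv → ¬leafy-b (zv⇒leafy i zv))) ⟩
        (# (i Fin.≟ next k) ℕ.+ 1) ℕ.+ (# (i Fin.≟ k) ℕ.+ 1) ≡⟨ rearrange (# (i Fin.≟ next k)) (# (i Fin.≟ k)) ⟩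
        2 ℕ.+ # (i Fin.≟ next k) ℕ.+ # (i Fin.≟ k) ∎
        where
        open ≤-Reasoning
        open import Data.Nat.Tactic.RingSolver using (solve-∀)
        rearrange : ∀ j l → (j ℕ.+ 1) ℕ.+ (l ℕ.+ 1) ≡ 2 ℕ.+ j ℕ.+ l
        rearrange = solve-∀

  linked⇒leaves≤ : (∀ i → Linked i) → leaves F ≤ n ℕ.* 2 ℕ.+ 2
  -- The predicate is taken twice, since the only copy with a cut may have 2 + 1 + 1 leaves.
  linked⇒leaves≤ linked = leaves≤-by (λ i → 2 <? leafCount i) (λ i → 2 <? leafCount i) big! big! bound
    where
    local : ∀ i → leafCount i ≤ 2 ⊎ (Cut i × leafCount i ≤ 4)
    local i = linked⇒leafCount≤ i (subst (λ j → (j , a) ~ (prev i , b)) (next-prev i) (~-sym (linked (prev i)))) (linked i)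

    big⇒cut : ∀ {i} → 2 < leafCount i → Cut i
    big⇒cut {i} big = [ (λ small → contradiction small (<⇒≱ big)) , proj₁ ]′ (local i)

    big! : ∀ {i j} → 2 < leafCount i → 2 < leafCount j → i ≡ j
    big! big big′ = cut-index-unique (big⇒cut big) (big⇒cut big′)

    bound : ∀ i → leafCount i ≤ 2 ℕ.+ # (2 <? leafCount i) ℕ.+ # (2 <? leafCount i)
    bound i = case 2 <? leafCount i of λ
      { (yes big)  → subst (λ k → leafCount i ≤ 2 ℕ.+ k ℕ.+ k) (sym (#≡1 (2 <? leafCount i) big))
          ([ (λ small → ≤-trans small (s≤s (s≤s z≤n))) , proj₂ ]′ (local i))
      ; (no small) → ≤-trans (≮⇒≥ small) (s≤s (s≤s z≤n)) }

  leaves≤ : leaves F ≤ n ℕ.* 2 ℕ.+ 2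
  leaves≤ with any? (¬? ∘ linked?)
  ... | yes (_ , ¬linked) = ¬linked⇒leaves≤ ¬linked
  ... | no all-linked     = linked⇒leaves≤ λ i → decidable-stable (linked? i) λ ¬l → all-linked (i , ¬l)

-- The weighted degree count in the rationals

-- Among unnormalised rationals no common factors are cancelled, and the claim becomes an identity
-- of integers.
fromℕ-+ : ∀ k l → fromℕ (k ℕ.+ l) ≡ fromℕ k + fromℕ l
fromℕ-+ k l = ℚ.toℚᵘ-injective (begin
  toℚᵘ (fromℕ (k ℕ.+ l))              ≈⟨ ℚ.toℚᵘ-fromℚᵘ (mkℚᵘ (+ (k ℕ.+ l)) 0) ⟩
  mkℚᵘ (+ (k ℕ.+ l)) 0                ≈⟨ *≡* (cong (ℤ._* + 1) (trans (ℤ.pos-+ k l) (solve (+ k) (+ l)))) ⟩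
  mkℚᵘ (+ k) 0 ℚᵘ.+ mkℚᵘ (+ l) 0
    ≈⟨ ℚᵘ.+-cong (ℚ.toℚᵘ-fromℚᵘ (mkℚᵘ (+ k) 0)) (ℚ.toℚᵘ-fromℚᵘ (mkℚᵘ (+ l) 0)) ⟨
  toℚᵘ (fromℕ k) ℚᵘ.+ toℚᵘ (fromℕ l)  ≈⟨ ℚ.toℚᵘ-homo-+ (fromℕ k) (fromℕ l) ⟨
  toℚᵘ (fromℕ k + fromℕ l)            ∎)
  where
  open ℚᵘ.≃-Reasoning
  open import Data.Integer.Tactic.RingSolver using (solve-∀)
  solve : ∀ i j → i ℤ.+ j ≡ i ℤ.* + 1 ℤ.+ j ℤ.* + 1
  solve = solve-∀

-- Each copy has four vertices of degree 4 and two of degree 3.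
weighted-degree-count : ∀ n → (+ 2 / 5) * fromℕ (n ℕ.* 4) + (+ 1 / 5) * fromℕ (n ℕ.* 2) ≡ fromℕ (2 ℕ.* n)
weighted-degree-count n = ℚ.toℚᵘ-injective (begin
  toℚᵘ ((+ 2 / 5) * fromℕ (n ℕ.* 4) + (+ 1 / 5) * fromℕ (n ℕ.* 2))
    ≈⟨ ℚ.toℚᵘ-homo-+ ((+ 2 / 5) * fromℕ (n ℕ.* 4)) ((+ 1 / 5) * fromℕ (n ℕ.* 2)) ⟩
  toℚᵘ ((+ 2 / 5) * fromℕ (n ℕ.* 4)) ℚᵘ.+ toℚᵘ ((+ 1 / 5) * fromℕ (n ℕ.* 2))
    ≈⟨ ℚᵘ.+-cong (scaled (+ 2 / 5) (n ℕ.* 4)) (scaled (+ 1 / 5) (n ℕ.* 2)) ⟩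
  mkℚᵘ (+ 2) 4 ℚᵘ.* mkℚᵘ (+ (n ℕ.* 4)) 0 ℚᵘ.+ mkℚᵘ (+ 1) 4 ℚᵘ.* mkℚᵘ (+ (n ℕ.* 2)) 0
    ≈⟨ *≡* numerators ⟩
  mkℚᵘ (+ (2 ℕ.* n)) 0
    ≈⟨ ℚ.toℚᵘ-fromℚᵘ (mkℚᵘ (+ (2 ℕ.* n)) 0) ⟨
  toℚᵘ (fromℕ (2 ℕ.* n)) ∎)
  where
  open ℚᵘ.≃-Reasoning
  open import Data.Integer.Tactic.RingSolver using (solve-∀)

  scaled : ∀ q k → toℚᵘ (q * fromℕ k) ℚᵘ.≃ toℚᵘ q ℚᵘ.* mkℚᵘ (+ k) 0
  scaled q k = ℚᵘ.≃-trans (ℚ.toℚᵘ-homo-* q (fromℕ k)) (ℚᵘ.*-congˡ {toℚᵘ q} (ℚ.toℚᵘ-fromℚᵘ (mkℚᵘ (+ k) 0)))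

  -- The factor 25 is the product of the two denominators, which the unnormalised sum keeps.
  solve : ∀ i → (+ 2 ℤ.* (i ℤ.* + 4) ℤ.* + 5 ℤ.+ + 1 ℤ.* (i ℤ.* + 2) ℤ.* + 5) ℤ.* + 1 ≡ (+ 2 ℤ.* i) ℤ.* + 25
  solve = solve-∀

  numerators : (+ 2 ℤ.* + (n ℕ.* 4) ℤ.* + 5 ℤ.+ + 1 ℤ.* + (n ℕ.* 2) ℤ.* + 5) ℤ.* + 1 ≡ + (2 ℕ.* n) ℤ.* + 25
  numerators = trans
    (cong₂ (λ i j → (+ 2 ℤ.* i ℤ.* + 5 ℤ.+ + 1 ℤ.* j ℤ.* + 5) ℤ.* + 1) (ℤ.pos-* n 4) (ℤ.pos-* n 2))
    (trans (solve (+ n)) (cong (ℤ._* + 25) (sym (ℤ.pos-* 2 n))))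

-- Degrees, caterpillar and upper bound combined

mainTheorem2 : (n : ℕ) → 1 < n →
    let s = Graph.numberOfDegree (H n) 3
        t = Graph.numberOfDegree (H n) 4
    in Connected (H n)
     × (∀ p → Graph.degree (H n) p ≡ 3 ⊎ Graph.degree (H n) p ≡ 4)
     × (+ 2 / 5) * fromℕ t + (+ 1 / 5) * fromℕ s ≡ fromℕ (2 ℕ.* n)
     × u[ H n ]≡ (2 ℕ.* n ℕ.+ 2)
     × fromℕ (2 ℕ.* n ℕ.+ 2) ≡ (+ 2 / 5) * fromℕ t + (+ 1 / 5) * fromℕ s + fromℕ 2
mainTheorem2 (suc zero) (s≤s ())
mainTheorem2 n@(suc (suc m)) 1<n =
    -- Walks in the caterpillar are walks in `H n`.
    (λ p q → Star.map (proj₁ Tree.isSpanningTree) (Tree.connected p q))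
  , (λ p → subst (λ d → d ≡ 3 ⊎ d ≡ 4) (sym (degreeH 1<n p)) (degreeD-3-or-4 (proj₂ p)))
  , counts
  , ( (Tree.tree , Tree.isSpanningTree
        , ≤-antisym (upper Tree.tree Tree.isSpanningTree) (≤-trans (≤-reflexive 2n+2) Tree.leaves≥))
    , upper)
  , trans (fromℕ-+ (2 ℕ.* n) 2) (cong (_+ fromℕ 2) (sym counts))
  where
  module Tree = Caterpillar (suc m)

  2n+2 : 2 ℕ.* n ℕ.+ 2 ≡ n ℕ.* 2 ℕ.+ 2
  2n+2 = cong (ℕ._+ 2) (ℕ.*-comm 2 n)

  counts : (+ 2 / 5) * fromℕ (Graph.numberOfDegree (H n) 4) + (+ 1 / 5) * fromℕ (Graph.numberOfDegree (H n) 3)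
         ≡ fromℕ (2 ℕ.* n)
  counts = trans
    (cong₂ (λ k l → (+ 2 / 5) * fromℕ k + (+ 1 / 5) * fromℕ l) (numberOfDegreeH 1<n 4) (numberOfDegreeH 1<n 3))
    (weighted-degree-count n)

  upper : ∀ F → IsSpanningTree (H n) F → leaves F ≤ 2 ℕ.* n ℕ.+ 2
  upper F (F⊆H , F-connected , _) =
    ≤-trans (UpperBound.leaves≤ m F F⊆H F-connected) (≤-reflexive (sym 2n+2))
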